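{- For every positive integer $n$, $f(n,3,5)=n$.
   Context: A $3$-digraph $G$ consists of a finite vertex set $V(G)$ and an edge set $E(G)$ whose elements are ordered triples of distinct vertices. A $(3,k)$-tournament is a $3$-digraph $G$ such that for every $3$-element set $S\subseteq V(G)$, exactly $k$ of the $6$ orderings of $S$ are edges of $G$. The tight path $P^{(3)}_s$ is the $3$-digraph with $s$ distinct vertices $v_1,\ldots,v_s$ whose edges are exactly the triples $(v_i,v_{i+1},v_{i+2})$, $1\le i\le s-2$ (no edges if $s<3$). A $3$-digraph $G$ contains $P^{(3)}_s$ if there is an injection of its vertices into $V(G)$ mapping edges to edges. $f(n,3,k)$ is the maximum integer $s$ such that every $n$-vertex $(3,k)$-tournament contains a copy of $P^{(3)}_s$; thus $f(n,3,k)=n$ means every $n$-vertex $(3,k)$-tournament has a spanning tight path. -}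

module Defs where

open import Data.Fin using (Fin; toℕ)
open import Data.List using (List; []; _∷_; filter; length)
open import Data.Nat using (ℕ; suc; _≤_; _≟_)
open import Data.Nat.Properties using (1+n≢n; suc-injective)
open import Data.Product using (_×_; _,_; ∃-syntax)
open import Function.Definitions using (Injective)
open import Level using (0ℓ)
open import Relation.Binary.PropositionalEquality using (_≡_; _≢_; refl; cong; sym; trans)
open import Relation.Nullary.Decidable using (_×-dec_)
open import Relation.Unary using (Pred; Decidable)

Triple : ℕ → Set
Triple n = Fin n × Fin n × Fin n

Distinct : ∀ {n} → Pred (Triple n) 0ℓ
Distinct (a , b , c) = a ≢ b × a ≢ c × b ≢ c

-- 3-digraphs on the vertex set Fin n; an edge set is a decidable set of triples.
record Digraph₃ (n : ℕ) : Set₁ where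
  field
    Edge     : Pred (Triple n) 0ℓ
    edge?    : Decidable Edge
    distinct : ∀ {t} → Edge t → Distinct t

orderings : ∀ {n} → Triple n → List (Triple n)
orderings (a , b , c) =
  (a , b , c) ∷ (a , c , b) ∷ (b , a , c) ∷ (b , c , a) ∷ (c , a , b) ∷ (c , b , a) ∷ []

-- A 3-element set S is presented by any triple listing its elements; the
-- count below does not depend on which of the six is chosen.
IsTournament : ∀ {n} → ℕ → Digraph₃ n → Set
IsTournament k G = ∀ t → Distinct t → length (filter edge? (orderings t)) ≡ k
  where open Digraph₃ G

tightPath : ∀ s → Digraph₃ s
tightPath s = record
  { Edge     = λ (i , j , k) → toℕ j ≡ suc (toℕ i) × toℕ k ≡ suc (toℕ j)
  ; edge?    = λ (i , j , k) → (toℕ j ≟ suc (toℕ i)) ×-dec (toℕ k ≟ suc (toℕ j))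
  ; distinct = λ {(i , j , k)} (p , q) →
        (λ { refl → 1+n≢n (sym p) })
      , (λ { refl → i≢2+i (toℕ i) (trans q (cong suc p)) })
      , (λ { refl → 1+n≢n (sym q) })
  }
  where
  i≢2+i : ∀ m → m ≢ suc (suc m)
  i≢2+i (suc m) e = i≢2+i m (suc-injective e)

Contains : ∀ {n m} → Digraph₃ n → Digraph₃ m → Set
Contains {n} {m} G H =
  ∃[ φ ] Injective {A = Fin m} {B = Fin n} _≡_ _≡_ φ
       × (∀ {a b c} → Edge H (a , b , c) → Edge G (φ a , φ b , φ c))
  where open Digraph₃

IsMaximumOf : ∀ {ℓ} → Pred ℕ ℓ → Pred ℕ ℓ
IsMaximumOf P s = P s × (∀ t → P t → t ≤ s)

EveryTournamentContainsPath : ℕ → ℕ → Pred ℕ _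
EveryTournamentContainsPath n k s =
  ∀ (G : Digraph₃ n) → IsTournament k G → Contains G (tightPath s)

-- f⟨ n ,3, k ⟩≡ s  is the graph of the function f: it says f(n,3,k) = s.
f⟨_,3,_⟩≡_ : ℕ → ℕ → ℕ → Set₁
f⟨ n ,3, k ⟩≡ s = IsMaximumOf (EveryTournamentContainsPath n k) s

-- A spanning tight path is built by inserting the vertices one at a time.
-- In a (3,5)-tournament, if (v , p , q) is not an edge then all other orderings
-- of {v , p , q} are.  So given a tight path v₁ … vₘ and a new vertex v, insert v
-- before vᵢ for the least i such that (v , vᵢ , vᵢ₊₁) is an edge, or at the end if
-- there is none: minimality makes (vᵢ₋₂ , vᵢ₋₁ , v) and (vᵢ₋₁ , v , vᵢ) edges.
-- The maximum is not larger than n since (3,5)-tournaments on n vertices exist: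
-- take all distinct triples except the increasing ones.
module Submission where

open import Defs
open import Data.Fin as Fin using (Fin; zero; suc; toℕ)
open import Data.Fin.Properties using (_≟_; _<?_; <-cmp; <-asym; <-trans; <⇒≢; injective⇒≤)
open import Data.List using (List; []; _∷_; filter; length; lookup)
open import Data.List.Properties
  using (filter-all; filter-complete; filter-reject; length-tabulate)
open import Data.List.Relation.Binary.Permutation.Propositional
  using (_↭_; refl; prep; swap; trans; ↭-sym; ↭⇒↭ₛ)
open import Data.List.Relation.Binary.Permutation.Propositional.Properties
  using (++-comm; ++⁺ˡ; ++⁺ʳ; filter-↭; ↭-length; shift)
import Data.List.Relation.Binary.Permutation.Setoid.Properties as Permutation
open import Data.List.Relation.Unary.All as All using (All; []; _∷_)
open import Data.List.Relation.Unary.All.Properties using (all-filter)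
open import Data.List.Relation.Unary.Unique.Propositional using (Unique; _∷_)
open import Data.List.Relation.Unary.Unique.Propositional.Properties using (allFin⁺)
open import Data.List.Membership.Propositional.Properties using (∈-lookup)
open import Data.Nat as ℕ using (ℕ; NonZero)
open import Data.Nat.Properties using (suc-injective)
open import Data.Product using (_×_; _,_; proj₁; proj₂; ∃-syntax)
open import Function using (_∘_)
open import Function.Definitions using (Injective)
open import Relation.Binary.Definitions using (tri<; tri≈; tri>)
open import Relation.Binary.PropositionalEquality as ≡
  using (_≡_; _≢_; cong; subst; ≢-sym)
open import Relation.Nullary using (¬_; yes; no; contradiction)
open import Relation.Nullary.Decidable using (¬?; _×-dec_)

lookup-injective : ∀ {a} {A : Set a} {xs : List A} → Unique xs → Injective _≡_ _≡_ (lookup xs)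
lookup-injective {xs = x ∷ xs} (x∉xs ∷ u) {zero}  {zero}  eq = ≡.refl
lookup-injective {xs = x ∷ xs} (x∉xs ∷ u) {zero}  {suc j} eq =
  contradiction eq (All.lookup x∉xs (∈-lookup j))
lookup-injective {xs = x ∷ xs} (x∉xs ∷ u) {suc i} {zero}  eq =
  contradiction (≡.sym eq) (All.lookup x∉xs (∈-lookup i))
lookup-injective {xs = x ∷ xs} (x∉xs ∷ u) {suc i} {suc j} eq =
  cong suc (lookup-injective u eq)

Unique-resp-↭ : ∀ {a} {A : Set a} {xs ys : List A} → xs ↭ ys → Unique xs → Unique ys
Unique-resp-↭ {A = A} = Permutation.Unique-resp-↭ (≡.setoid A) ∘ ↭⇒↭ₛ

module _ {n} (G : Digraph₃ n) where
  open Digraph₃ G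

  infixr 5 _∷_

  -- A path given as the list of its vertices, so that insertion becomes a recursion on lists;
  -- `consecutive-edge` leads back to the index form used by `tightPath`.
  data IsTightPath : List (Fin n) → Set where
    []    : IsTightPath []
    [-]   : ∀ {x} → IsTightPath (x ∷ [])
    [-,-] : ∀ {x y} → IsTightPath (x ∷ y ∷ [])
    _∷_   : ∀ {x y z xs} → Edge (x , y , z) → IsTightPath (y ∷ z ∷ xs) →
            IsTightPath (x ∷ y ∷ z ∷ xs)

  consecutive-edge : ∀ {xs} → IsTightPath xs → ∀ i j k →
    toℕ j ≡ ℕ.suc (toℕ i) → toℕ k ≡ ℕ.suc (toℕ j) →
    Edge (lookup xs i , lookup xs j , lookup xs k)
  consecutive-edge [-]     zero       zero       _                ()     _
  consecutive-edge [-,-]   _          (suc zero) (suc zero)       _      ()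
  consecutive-edge [-,-]   (suc zero) (suc zero) zero             _      ()
  consecutive-edge (e ∷ t) zero       (suc zero) (suc (suc zero)) _      _      = e
  consecutive-edge (e ∷ t) (suc i)    (suc j)    (suc k)          j≡1+i  k≡1+j  =
    consecutive-edge t i j k (suc-injective j≡1+i) (suc-injective k≡1+j)

  contains-tightPath : ∀ {xs} → Unique xs → IsTightPath xs → Contains G (tightPath (length xs))
  contains-tightPath {xs} u t =
    lookup xs , lookup-injective u , λ (p , q) → consecutive-edge t _ _ _ p q

  module _ (tournament : IsTournament 5 G) where

    -- Five of the six orderings are edges and the first is not, so filtering the other five drops
    -- nothing. Only the two orderings needed for insertion are returned.
    nonEdge⇒edges : ∀ {v p q} → Distinct (v , p , q) → ¬ Edge (v , p , q) →
      Edge (p , v , q) × Edge (p , q , v)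
    nonEdge⇒edges {v} {p} {q} d ¬e with others
      where
      rest : List (Triple n)
      rest = (v , q , p) ∷ (p , v , q) ∷ (p , q , v) ∷ (q , v , p) ∷ (q , p , v) ∷ []

      others : All Edge rest
      others = subst (All Edge)
        (filter-complete edge?
          (≡.trans (cong length (≡.sym (filter-reject edge? ¬e))) (tournament (v , p , q) d)))
        (all-filter edge? rest)
    ... | _ ∷ pvq ∷ pqv ∷ _ = pvq , pqv

    -- The search in progress: `v` has been refused before `p` and before `q`. These refusals
    -- provide the edges `(p , q , v)` and `(q , v , x)` for a place between `q` and `x`. Keeping
    -- `p` and `q` in front lets the caller prepend the earlier edges unchanged.
    insert-after : ∀ {v p q x xs} → Unique (v ∷ p ∷ q ∷ x ∷ xs) →
      ¬ Edge (v , p , q) → ¬ Edge (v , q , x) → IsTightPath (p ∷ q ∷ x ∷ xs) →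
      ∃[ zs ] zs ↭ v ∷ x ∷ xs × IsTightPath (p ∷ q ∷ zs)
    insert-after {v} {p} {q} {x} {[]} ((_ ∷ v≢q ∷ v≢x ∷ _) ∷ _ ∷ (q≢x ∷ _) ∷ _) ¬vpq ¬vqx (e ∷ t) =
      x ∷ v ∷ [] , swap x v refl ,
      -- No place is left but the end, where the last refusal gives `(q , x , v)`.
      e ∷ proj₂ (nonEdge⇒edges (v≢q , v≢x , q≢x) ¬vqx) ∷ [-,-]
    insert-after {v} {p} {q} {x} {y ∷ xs}
      ((v≢p ∷ v≢q ∷ v≢x ∷ v∉) ∷ (p≢q ∷ _) ∷ u@((q≢x ∷ _) ∷ _)) ¬vpq ¬vqx (e ∷ t@(_ ∷ t′))
      with edge? (v , x , y)
    ... | yes vxy =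
      v ∷ x ∷ y ∷ xs , refl ,
      proj₂ (nonEdge⇒edges (v≢p , v≢q , p≢q) ¬vpq) ∷
      proj₁ (nonEdge⇒edges (v≢q , v≢x , q≢x) ¬vqx) ∷ vxy ∷ t′
    ... | no ¬vxy with insert-after ((v≢q ∷ v≢x ∷ v∉) ∷ u) ¬vqx ¬vxy t
    ...   | zs , zs↭ , t″ = x ∷ zs , trans (prep x zs↭) (swap x v refl) , e ∷ t″

    -- The first two places are handled here because there `v` has fewer than two predecessors;
    -- later ones are left to `insert-after`.
    insert : ∀ {v xs} → Unique (v ∷ xs) → IsTightPath xs → ∃[ zs ] zs ↭ v ∷ xs × IsTightPath zs
    insert {v} {[]}         _ _ = v ∷ [] , refl , [-]
    insert {v} {a ∷ []}     _ _ = v ∷ a ∷ [] , refl , [-,-]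
    insert {v} {a ∷ b ∷ xs} u t with edge? (v , a , b)
    ... | yes vab = v ∷ a ∷ b ∷ xs , refl , vab ∷ t
    insert {v} {a ∷ b ∷ []} ((v≢a ∷ v≢b ∷ _) ∷ (a≢b ∷ _) ∷ _) t | no ¬vab =
      a ∷ b ∷ v ∷ [] , shift v (a ∷ b ∷ []) [] ,
      proj₂ (nonEdge⇒edges (v≢a , v≢b , a≢b) ¬vab) ∷ [-,-]
    insert {v} {a ∷ b ∷ x ∷ xs} u@((v≢a ∷ v≢b ∷ _) ∷ (a≢b ∷ _) ∷ _) t@(_ ∷ t′) | no ¬vab
      with edge? (v , b , x)
    ... | yes vbx =
      a ∷ v ∷ b ∷ x ∷ xs , swap a v refl ,
      proj₁ (nonEdge⇒edges (v≢a , v≢b , a≢b) ¬vab) ∷ vbx ∷ t′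
    ... | no ¬vbx with insert-after u ¬vab ¬vbx t
    ...   | zs , zs↭ , t″ =
      a ∷ b ∷ zs , trans (prep a (prep b zs↭)) (shift v (a ∷ b ∷ []) (x ∷ xs)) , t″

    reorder : ∀ {xs} → Unique xs → ∃[ ys ] ys ↭ xs × IsTightPath ys
    reorder {[]}     _ = [] , refl , []
    reorder {x ∷ xs} u@(_ ∷ u′) with reorder u′
    ... | ys , ys↭xs , t with insert (Unique-resp-↭ (prep x (↭-sym ys↭xs)) u) t
    ...   | zs , zs↭ , t′ = zs , trans zs↭ (prep x ys↭xs) , t′

    spanning : Contains G (tightPath n)
    spanning with reorder (allFin⁺ n)
    ... | ys , ys↭ , t =
      subst (Contains G ∘ tightPath)
        (≡.trans (↭-length ys↭) (length-tabulate {n = n} (λ i → i)))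
        (contains-tightPath (Unique-resp-↭ (↭-sym ys↭) (allFin⁺ n)) t)

Increasing : ∀ {n} → Triple n → Set
Increasing (a , b , c) = a Fin.< b × b Fin.< c

nonIncreasing : ∀ n → Digraph₃ n
nonIncreasing n = record
  { Edge     = λ t → Distinct t × ¬ Increasing t
  ; edge?    = λ (a , b , c) →
      (¬? (a ≟ b) ×-dec ¬? (a ≟ c) ×-dec ¬? (b ≟ c)) ×-dec ¬? ((a <? b) ×-dec (b <? c))
  ; distinct = proj₁
  }

-- The two adjacent transpositions generate all rearrangements of a triple, so with
-- `orderings-swap₂₃` every count reduces to that of an increasing triple.
orderings-swap₁₂ : ∀ {n} (a b c : Fin n) → orderings (a , b , c) ↭ orderings (b , a , c)
orderings-swap₁₂ a b c = trans
  (++⁺ʳ (cab ∷ cba ∷ []) (++-comm (abc ∷ acb ∷ []) (bac ∷ bca ∷ [])))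
  (++⁺ˡ (bac ∷ bca ∷ abc ∷ acb ∷ []) (swap cab cba refl))
  where
  abc = a , b , c
  acb = a , c , b
  bac = b , a , c
  bca = b , c , a
  cab = c , a , b
  cba = c , b , a

orderings-swap₂₃ : ∀ {n} (a b c : Fin n) → orderings (a , b , c) ↭ orderings (a , c , b)
orderings-swap₂₃ a b c = swap (a , b , c) (a , c , b)
  (++-comm ((b , a , c) ∷ (b , c , a) ∷ []) ((c , a , b) ∷ (c , b , a) ∷ []))

nonIncreasing-isTournament : ∀ n → IsTournament 5 (nonIncreasing n)
nonIncreasing-isTournament n = count
  where
  open Digraph₃ (nonIncreasing n)

  edgeCount : Triple n → ℕ
  edgeCount t = length (filter edge? (orderings t))

  edgeCount-resp-↭ : ∀ {s t} → orderings s ↭ orderings t → edgeCount s ≡ edgeCount t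
  edgeCount-resp-↭ s↭t = ↭-length (filter-↭ edge? s↭t)

  increasing : ∀ {a b c} → a Fin.< b → b Fin.< c → edgeCount (a , b , c) ≡ 5
  -- The head of the list is the increasing ordering; each of the other five has a descent between
  -- neighbours.
  increasing {a} {b} {c} a<b b<c = cong length (≡.trans
    (filter-reject edge? (λ (_ , ¬inc) → ¬inc (a<b , b<c)))
    (filter-all edge?
      ( ((a≢c , a≢b , ≢-sym b≢c) , λ (_ , c<b) → <-asym b<c c<b)
      ∷ ((≢-sym a≢b , b≢c , a≢c) , λ (b<a , _) → <-asym a<b b<a)
      ∷ ((b≢c , ≢-sym a≢b , ≢-sym a≢c) , λ (_ , c<a) → <-asym a<c c<a)
      ∷ ((≢-sym a≢c , ≢-sym b≢c , a≢b) , λ (c<a , _) → <-asym a<c c<a)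
      ∷ ((≢-sym b≢c , ≢-sym a≢c , ≢-sym a≢b) , λ (c<b , _) → <-asym b<c c<b)
      ∷ [])))
    where
    a<c = <-trans a<b b<c
    a≢b = <⇒≢ a<b
    a≢c = <⇒≢ a<c
    b≢c = <⇒≢ b<c

  -- Insertion sort: `c` moves left past `b`, then past `a`, as far as required, and each swap
  -- preserves the count.
  count-< : ∀ {a b c} → a Fin.< b → a ≢ c → b ≢ c → edgeCount (a , b , c) ≡ 5
  count-< {a} {b} {c} a<b a≢c b≢c with <-cmp b c
  ... | tri< b<c _ _ = increasing a<b b<c
  ... | tri≈ _ b≡c _ = contradiction b≡c b≢c
  ... | tri> _ _ c<b = ≡.trans (edgeCount-resp-↭ (orderings-swap₂₃ a b c)) acb
    where
    acb : edgeCount (a , c , b) ≡ 5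
    acb with <-cmp a c
    ... | tri< a<c _ _ = increasing a<c c<b
    ... | tri≈ _ a≡c _ = contradiction a≡c a≢c
    ... | tri> _ _ c<a =
      ≡.trans (edgeCount-resp-↭ (orderings-swap₁₂ a c b)) (increasing c<a a<b)

  count : ∀ t → Distinct t → edgeCount t ≡ 5
  count (a , b , c) (a≢b , a≢c , b≢c) with <-cmp a b
  ... | tri< a<b _ _ = count-< a<b a≢c b≢c
  ... | tri≈ _ a≡b _ = contradiction a≡b a≢b
  ... | tri> _ _ b<a =
    ≡.trans (edgeCount-resp-↭ (orderings-swap₁₂ a b c)) (count-< b<a b≢c a≢c)

proposition22 : ∀ (n : ℕ) → .{{_ : NonZero n}} → f⟨ n ,3, 5 ⟩≡ n
proposition22 n = spanning , λ t contains →
  -- A copy of the path in this one tournament is an injection from `Fin t` to `Fin n`.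
  injective⇒≤ (proj₁ (proj₂ (contains (nonIncreasing n) (nonIncreasing-isTournament n))))
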